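{- Let $\mathbf{a}=(a_1,\ldots,a_n)$ and $\mathbf{e}=(e_1,\ldots,e_n)$ be arbitrary real sequences of length $n$. The matrix $M_{\mathbf{e}\rightarrow\mathbf{a}}$ is totally non-negative if and only if $\mathbf{e}$ is a restricted growth sequence relative to $\mathbf{a}$.
   Context: For real sequences $\mathbf{a}=(a_1,\ldots,a_n)$, $\mathbf{e}=(e_1,\ldots,e_n)$, the polynomials $1, x-a_1, (x-a_1)(x-a_2),\ldots,\prod_{i=1}^n(x-a_i)$ form a basis of the real polynomials of degree at most $n$ (empty products equal $1$). $M_{\mathbf{e}\rightarrow\mathbf{a}}$ is the $(n+1)\times(n+1)$ matrix, with rows and columns indexed by $0,\ldots,n$, whose $(m,k)$ entry is the coefficient of $(x-a_1)\cdots(x-a_k)$ when $(x-e_1)\cdots(x-e_m)$ is expanded in this basis. A matrix is totally non-negative if all its minors (determinants of square submatrices) are non-negative. Restricted growth is defined by the following procedure on input $\mathbf{a},\mathbf{e}$: (1) Initialize the ordered list $X=(e_1,\ldots,e_n)$ and $i=1$. (2) While $i\le n$, locate the first element $e'$ of $X$ (in list order) with $e'\ge a_i$. (a) If no such element exists, delete the last element of $X$ and increase $i$ by $1$. (b) If $e'=a_i$, delete $e'$ from $X$ and increase $i$ by $1$. (c) If $e'>a_i$, stop and report the current value of $i$. (3) If $i=n+1$, stop and report $n+1$. The sequence $\mathbf{e}$ is a restricted growth sequence relative to $\mathbf{a}$ if this procedure terminates with the report $n+1$. -}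

module Defs where

open import Level using (Level; _⊔_) renaming (suc to lsuc)
open import Data.Nat using (ℕ; zero; suc)
open import Data.Fin using (Fin; zero; suc; toℕ; punchIn; _<_)
open import Data.Bool using (Bool; true; false)
open import Data.Maybe using (Maybe; just; nothing)
open import Data.Product using (Σ; _×_; _,_)
open import Data.List using (List; []; _∷_; _++_; take)
open import Data.Vec using (Vec; toList)
open import Relation.Nullary using (¬_; yes; no)
open import Relation.Binary using (Rel; IsDecTotalOrder)
open import Relation.Binary.PropositionalEquality using (_≡_)
open import Algebra.Bundles using (CommutativeRing)

-- Ordered fields (the stdlib has none).  The real numbers are the
-- intended model.  The order is a decidable
-- total order (as for ℝ classically), compatible with + and *.

record OrderedField (c ℓ₁ ℓ₂ : Level) : Set (lsuc (c ⊔ ℓ₁ ⊔ ℓ₂)) where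
  field
    commutativeRing : CommutativeRing c ℓ₁
  open CommutativeRing commutativeRing public
  field
    _≤_             : Rel Carrier ℓ₂
    isDecTotalOrder : IsDecTotalOrder _≈_ _≤_
    +-mono-≤        : ∀ {x y} z → x ≤ y → (x + z) ≤ (y + z)
    *-nonneg        : ∀ {x y} → 0# ≤ x → 0# ≤ y → 0# ≤ (x * y)
    0≉1             : ¬ (0# ≈ 1#)
    inverse         : ∀ x → ¬ (x ≈ 0#) → Σ Carrier (λ y → (x * y) ≈ 1#)
  open IsDecTotalOrder isDecTotalOrder public
    using (_≟_; _≤?_)

module _ {c ℓ₁ ℓ₂ : Level} (F : OrderedField c ℓ₁ ℓ₂) where
  open OrderedField F
    using (Carrier; _≈_; _+_; _*_; -_; _-_; 0#; 1#; _≤_; _≟_; _≤?_)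

  -- Polynomials over F as coefficient sequences (p j = coefficient of x^j).
  Poly : Set c
  Poly = ℕ → Carrier

  _≈ₚ_ : Poly → Poly → Set ℓ₁
  p ≈ₚ q = ∀ j → p j ≈ q j

  constP : Carrier → Poly
  constP u zero    = u
  constP u (suc j) = 0#

  zeroP : Poly
  zeroP _ = 0#

  _+ₚ_ : Poly → Poly → Poly
  (p +ₚ q) j = p j + q j

  scaleP : Carrier → Poly → Poly
  scaleP u p j = u * p j

  -- multiplication by the linear factor (x - u)
  mulLin : Carrier → Poly → Poly
  mulLin u p zero    = - (u * p zero)
  mulLin u p (suc j) = p j - (u * p (suc j))

  prodLin : List Carrier → Poly
  prodLin []       = constP 1#
  prodLin (u ∷ us) = mulLin u (prodLin us)

  partialProd : ∀ {n} → Vec Carrier n → ℕ → Poly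
  partialProd v m = prodLin (take m (toList v))

  sumFin : ∀ {k} → (Fin k → Carrier) → Carrier
  sumFin {zero}  f = 0#
  sumFin {suc k} f = f zero + sumFin (λ i → f (suc i))

  sumFinP : ∀ {k} → (Fin k → Poly) → Poly
  sumFinP {zero}  f = zeroP
  sumFinP {suc k} f = f zero +ₚ sumFinP (λ i → f (suc i))

  -- M_{e→a}: the (n+1)×(n+1) matrix (rows/cols indexed 0..n) whose (m,k)
  -- entry is the coefficient of (x-a₁)⋯(x-a_k) in the expansion of
  -- (x-e₁)⋯(x-e_m) in the basis 1, x-a₁, …, (x-a₁)⋯(x-a_n).
  -- Since this is a basis, M is the unique matrix with this property.
  IsChangeOfBasis : ∀ {n} → (e a : Vec Carrier n)
                  → (Fin (suc n) → Fin (suc n) → Carrier) → Set ℓ₁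
  IsChangeOfBasis {n} e a M =
    ∀ (m : Fin (suc n)) →
      partialProd e (toℕ m)
        ≈ₚ sumFinP (λ (k : Fin (suc n)) → scaleP (M m k) (partialProd a (toℕ k)))

  altSum : ∀ {k} → (Fin k → Carrier) → Carrier
  altSum {zero}  f = 0#
  altSum {suc k} f = f zero - altSum (λ i → f (suc i))

  det : ∀ {k} → (Fin k → Fin k → Carrier) → Carrier
  det {zero}  A = 1#
  det {suc k} A =
    altSum (λ j → A zero j * det (λ r s → A (suc r) (punchIn j s)))

  StrictlyIncreasing : ∀ {k N} → (Fin k → Fin N) → Set
  StrictlyIncreasing f = ∀ i j → i < j → f i < f j

  TotallyNonNegative : ∀ {N} → (Fin N → Fin N → Carrier) → Set ℓ₂
  TotallyNonNegative {N} M =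
    ∀ (k : ℕ) (r s : Fin k → Fin N) →
      StrictlyIncreasing r → StrictlyIncreasing s →
      0# ≤ det (λ i j → M (r i) (s j))

  firstGe : Carrier → List Carrier → Maybe (List Carrier × Carrier × List Carrier)
  firstGe u []       = nothing
  firstGe u (x ∷ xs) with u ≤? x
  ... | yes _ = just ([] , x , xs)
  ... | no  _ with firstGe u xs
  ...   | nothing               = nothing
  ...   | just (bs , y , as)    = just (x ∷ bs , y , as)

  dropLast : List Carrier → List Carrier
  dropLast []           = []
  dropLast (x ∷ [])     = []
  dropLast (x ∷ y ∷ xs) = x ∷ dropLast (y ∷ xs)

  -- run with the remaining a_i, a_{i+1}, …, a_n and the current list X;
  -- true iff the procedure reaches i = n+1
  rgRun : List Carrier → List Carrier → Bool
  rgRun []       X = true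
  rgRun (a ∷ as) X with firstGe a X
  ... | nothing            = rgRun as (dropLast X)
  ... | just (bs , e' , cs) with e' ≟ a
  ...   | yes _ = rgRun as (bs ++ cs)
  ...   | no  _ = false

  IsRestrictedGrowth : ∀ {n} → (e a : Vec Carrier n) → Set
  IsRestrictedGrowth e a = rgRun (toList a) (toList e) ≡ true

{-# OPTIONS --safe #-}
-- Write P_m = (x − e₁)⋯(x − e_m). One step of the procedure deletes one element from e, giving e′ with products
-- P′_m, and P_{m+1} = (x − a₁) P′_m + d_m P_m, where d_m = a₁ − e_{m+1} up to the deleted element and d_m = 0
-- afterwards. Comparing coefficients, row m+1 of M is row m+1 of 1 ⊕ N plus d_m times row m of M, where N is the
-- matrix of e′ relative to (a₂, …, a_n).
--
-- If d ≥ 0, these row operations preserve total non-negativity, so it passes from N to M. Conversely, the first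
-- column of M consists of the products d₀⋯d_{m−1}, so its non-negativity is what the step tests. In the other
-- direction only minors with consecutive rows are followed: when M b 0 > 0, undoing the row operations shows that
-- the minor of M with rows b, b+1, … and columns 0, S is M b 0 times a minor of N with consecutive rows, and when
-- M b 0 = 0 the rows of M below b are rows of N.

module Submission where

open import Defs
open import Level using (Level; _⊔_)
open import Algebra.Bundles using (CommutativeRing)
import Algebra.Properties.AbelianGroup as AbelianGroupProperties
import Algebra.Properties.Ring as RingProperties
import Algebra.Properties.Semiring.Mult.TCOptimised as SemiringMult
import Algebra.Solver.Ring as RingSolver
open import Algebra.Solver.Ring.AlmostCommutativeRing using (fromCommutativeRing; _-Raw-AlmostCommutative⟶_)
open import Data.Bool using (if_then_else_; true)
open import Data.Empty using (⊥-elim)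
open import Data.Fin using (Fin; zero; suc; toℕ; punchIn; inject₁)
import Data.Fin as Fin
open import Data.Fin.Induction using (<-weakInduction)
import Data.Fin.Properties as Fin
open import Data.Integer using (ℤ; +_; -[1+_]; _⊖_; _◃_)
import Data.Integer as ℤ
import Data.Integer.Properties as ℤ
open import Data.List using (List; []; _∷_; _++_; take; length)
open import Data.List.Properties using (length-take)
open import Data.Maybe using (just; nothing; map)
open import Data.Nat using (ℕ; zero; suc; z≤n; s≤s)
import Data.Nat as ℕ
import Data.Nat.Properties as ℕ
open import Data.Product using (Σ; ∃; _×_; _,_; proj₁; proj₂)
import Data.Sign as Sign
open import Data.Sum using (_⊎_; inj₁; inj₂)
open import Data.Vec using (Vec; toList)
open import Data.Vec.Functional using (updateAt)
open import Data.Vec.Functional.Properties using (updateAt-updates; updateAt-minimal)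
open import Data.Vec.Properties using (length-toList)
open import Function using (_∘_; const)
open import Relation.Binary using (IsDecTotalOrder; tri<; tri≈; tri>)
open import Relation.Binary.Consequences using (dec⇒weaklyDec)
open import Relation.Binary.PropositionalEquality as ≡ using (_≡_; _≢_)
import Relation.Binary.Reasoning.Setoid as SetoidReasoning
open import Relation.Nullary using (¬_; yes; no; does; contradiction)
open import Relation.Nullary.Decidable using (dec-true; dec-false)

-- The library's ring solver cancels x - x only over coefficients with computable equality,
-- hence the coefficients are taken in ℤ.
module IntegerCoefficients {r₁ r₂ : Level} (R : CommutativeRing r₁ r₂) where
  open CommutativeRing R hiding (zero)
  open AbelianGroupProperties +-abelianGroup using (⁻¹-∙-comm; ε⁻¹≈ε; ⁻¹-involutive)
  open RingProperties ring using (-‿distribˡ-*; -‿distribʳ-*)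
  open SemiringMult semiring using (1+×; ×-homo-+; ×1-homo-*) renaming (_×_ to _·_)
  open SetoidReasoning setoid

  fromℤ : ℤ → Carrier
  fromℤ (+ n)    = n · 1#
  fromℤ -[1+ n ] = - (suc n · 1#)

  fromℤ-neg : ∀ i → fromℤ (ℤ.- i) ≈ - fromℤ i
  fromℤ-neg (+ zero)  = sym ε⁻¹≈ε
  fromℤ-neg (+ suc n) = refl
  fromℤ-neg -[1+ n ]  = sym (⁻¹-involutive _)

  fromℤ-⊖ : ∀ m n → fromℤ (m ⊖ n) ≈ m · 1# - n · 1#
  fromℤ-⊖ m zero = sym (trans (+-congˡ ε⁻¹≈ε) (+-identityʳ _))
  fromℤ-⊖ zero (suc n) = sym (+-identityˡ _)
  fromℤ-⊖ (suc m) (suc n) = begin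
    fromℤ (suc m ⊖ suc n)              ≡⟨ ≡.cong fromℤ (ℤ.[1+m]⊖[1+n]≡m⊖n m n) ⟩
    fromℤ (m ⊖ n)                      ≈⟨ fromℤ-⊖ m n ⟩
    m · 1# - n · 1#                    ≈⟨ +-identityˡ _ ⟨
    0# + (m · 1# - n · 1#)             ≈⟨ +-congʳ (-‿inverseʳ 1#) ⟨
    1# - 1# + (m · 1# - n · 1#)        ≈⟨ +-assoc _ _ _ ⟩
    1# + (- 1# + (m · 1# - n · 1#))    ≈⟨ +-congˡ (trans (sym (+-assoc _ _ _)) (trans (+-congʳ (+-comm _ _)) (+-assoc _ _ _))) ⟩
    1# + (m · 1# + (- 1# - n · 1#))    ≈⟨ +-assoc _ _ _ ⟨
    1# + m · 1# + (- 1# - n · 1#)      ≈⟨ +-cong (sym (1+× m 1#)) (trans (⁻¹-∙-comm _ _) (-‿cong (sym (1+× n 1#)))) ⟩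
    suc m · 1# - suc n · 1#            ∎

  fromℤ-+ : ∀ i j → fromℤ (i ℤ.+ j) ≈ fromℤ i + fromℤ j
  fromℤ-+ (+ m)    (+ n)    = ×-homo-+ 1# m n
  fromℤ-+ (+ m)    -[1+ n ] = fromℤ-⊖ m (suc n)
  fromℤ-+ -[1+ m ] (+ n)    = trans (fromℤ-⊖ n (suc m)) (+-comm _ _)
  fromℤ-+ -[1+ m ] -[1+ n ] = trans
    (-‿cong (trans (reflexive (≡.cong (_· 1#) (≡.cong suc (≡.sym (ℕ.+-suc m n))))) (×-homo-+ 1# (suc m) (suc n))))
    (sym (⁻¹-∙-comm _ _))

  fromℤ-* : ∀ i j → fromℤ (i ℤ.* j) ≈ fromℤ i * fromℤ j
  fromℤ-* (+ m)    (+ n)    = trans (reflexive (≡.cong fromℤ (ℤ.+◃n≡+n (m ℕ.* n)))) (×1-homo-* m n)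
  fromℤ-* (+ m)    -[1+ n ] = begin
    fromℤ (Sign.- ◃ m ℕ.* suc n) ≡⟨ ≡.cong fromℤ (ℤ.-◃n≡-n (m ℕ.* suc n)) ⟩
    fromℤ (ℤ.- + (m ℕ.* suc n))  ≈⟨ fromℤ-neg (+ (m ℕ.* suc n)) ⟩
    - ((m ℕ.* suc n) · 1#)       ≈⟨ -‿cong (×1-homo-* m (suc n)) ⟩
    - (m · 1# * suc n · 1#)      ≈⟨ -‿distribʳ-* _ _ ⟩
    m · 1# * - (suc n · 1#)      ∎
  fromℤ-* -[1+ m ] (+ n)    = begin
    fromℤ (Sign.- ◃ suc m ℕ.* n) ≡⟨ ≡.cong fromℤ (ℤ.-◃n≡-n (suc m ℕ.* n)) ⟩
    fromℤ (ℤ.- + (suc m ℕ.* n))  ≈⟨ fromℤ-neg (+ (suc m ℕ.* n)) ⟩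
    - ((suc m ℕ.* n) · 1#)       ≈⟨ -‿cong (×1-homo-* (suc m) n) ⟩
    - (suc m · 1# * n · 1#)      ≈⟨ -‿distribˡ-* _ _ ⟩
    - (suc m · 1#) * n · 1#      ∎
  fromℤ-* -[1+ m ] -[1+ n ] = begin
    (suc m ℕ.* suc n) · 1#           ≈⟨ ×1-homo-* (suc m) (suc n) ⟩
    suc m · 1# * suc n · 1#          ≈⟨ ⁻¹-involutive _ ⟨
    - - (suc m · 1# * suc n · 1#)    ≈⟨ -‿cong (-‿distribʳ-* _ _) ⟩
    - (suc m · 1# * - (suc n · 1#))  ≈⟨ -‿distribˡ-* _ _ ⟩
    - (suc m · 1#) * - (suc n · 1#)  ∎

  morphism : CommutativeRing.rawRing ℤ.+-*-commutativeRing -Raw-AlmostCommutative⟶ fromCommutativeRing R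
  morphism = record
    { ⟦_⟧    = fromℤ
    ; +-homo = fromℤ-+
    ; *-homo = fromℤ-*
    ; -‿homo = fromℤ-neg
    ; 0-homo = refl
    ; 1-homo = refl
    }

  open RingSolver _ _ morphism (λ i j → map (λ i≡j → reflexive (≡.cong fromℤ i≡j)) (dec⇒weaklyDec ℤ._≟_ i j)) public
    using (solve; con; _:+_; _:-_; _:*_; :-_; _:=_)

module _ {c ℓ₁ ℓ₂ : Level} (F : OrderedField c ℓ₁ ℓ₂) where
  open OrderedField F hiding (zero; ring) renaming (_≤_ to infix 4 _≤_)
  open IntegerCoefficients commutativeRing
  open SetoidReasoning setoid
  private
    module ≤ = IsDecTotalOrder isDecTotalOrder

  infix 4 _<_

  -- As the order is total, negating `≤` gives the strict order. In this form a failed test `a ≤? x`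
  -- is already a proof of `x < a`.
  _<_ : Carrier → Carrier → Set ℓ₂
  x < y = ¬ (y ≤ x)

  -- Ordered fields

  ≤-respʳ : ∀ {x y z} → y ≈ z → x ≤ y → x ≤ z
  ≤-respʳ = ≤.≤-respʳ-≈

  <⇒≤ : ∀ {x y} → x < y → x ≤ y
  <⇒≤ {x} {y} x<y with ≤.total x y
  ... | inj₁ x≤y = x≤y
  ... | inj₂ y≤x = contradiction y≤x x<y

  x≤y⇒0≤y-x : ∀ {x y} → x ≤ y → 0# ≤ y - x
  x≤y⇒0≤y-x {x} x≤y = ≤.≤-respˡ-≈ (-‿inverseʳ x) (+-mono-≤ (- x) x≤y)

  0≤y-x⇒x≤y : ∀ {x y} → 0# ≤ y - x → x ≤ y
  0≤y-x⇒x≤y {x} {y} 0≤y-x = ≤.≤-respˡ-≈ (+-identityˡ x) (≤-respʳ (cancel x y) (+-mono-≤ x 0≤y-x))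
    where
    cancel : ∀ x y → (y - x) + x ≈ y
    cancel = solve 2 (λ x y → (y :- x) :+ x := y) refl

  x≤0⇒0≤-x : ∀ {x} → x ≤ 0# → 0# ≤ - x
  x≤0⇒0≤-x {x} x≤0 = ≤-respʳ (+-identityˡ (- x)) (x≤y⇒0≤y-x x≤0)

  0≤-x⇒x≤0 : ∀ {x} → 0# ≤ - x → x ≤ 0#
  0≤-x⇒x≤0 {x} 0≤-x = 0≤y-x⇒x≤y (≤-respʳ (sym (+-identityˡ (- x))) 0≤-x)

  +-nonneg : ∀ {x y} → 0# ≤ x → 0# ≤ y → 0# ≤ x + y
  +-nonneg {x} {y} 0≤x 0≤y = ≤.trans 0≤y (≤.≤-respˡ-≈ (+-identityˡ y) (+-mono-≤ y 0≤x))

  0≤1 : 0# ≤ 1#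
  0≤1 with ≤.total 0# 1#
  ... | inj₁ 0≤1 = 0≤1
  ... | inj₂ 1≤0 = ≤-respʳ square (*-nonneg (x≤0⇒0≤-x 1≤0) (x≤0⇒0≤-x 1≤0))
    where
    square : (- 1#) * (- 1#) ≈ 1#
    square = solve 0 ((:- con (+ 1)) :* (:- con (+ 1)) := con (+ 1)) refl

  0<1 : 0# < 1#
  0<1 1≤0 = 0≉1 (≤.antisym 0≤1 1≤0)

  -- Multiply by the inverse z of x. If z were at most 0, then x * (- z) = - 1 would be
  -- non-negative.
  *-cancelˡ-nonneg : ∀ {x y} → 0# < x → 0# ≤ x * y → 0# ≤ y
  *-cancelˡ-nonneg {x} {y} 0<x 0≤xy with inverse x (λ x≈0 → 0<x (≤.reflexive x≈0))
  ... | z , xz≈1 with ≤.total 0# z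
  ...   | inj₁ 0≤z = ≤-respʳ z[xy]≈y (*-nonneg 0≤z 0≤xy)
    where
    reassoc : ∀ x y z → z * (x * y) ≈ (x * z) * y
    reassoc = solve 3 (λ x y z → z :* (x :* y) := (x :* z) :* y) refl
    z[xy]≈y : z * (x * y) ≈ y
    z[xy]≈y = trans (reassoc x y z) (trans (*-congʳ xz≈1) (*-identityˡ y))
  ...   | inj₂ z≤0 = contradiction (0≤-x⇒x≤0 (≤-respʳ x[-z]≈-1 (*-nonneg (<⇒≤ 0<x) (x≤0⇒0≤-x z≤0)))) 0<1
    where
    neg : ∀ x z → x * (- z) ≈ - (x * z)
    neg = solve 2 (λ x z → x :* (:- z) := :- (x :* z)) refl
    x[-z]≈-1 : x * (- z) ≈ - 1#
    x[-z]≈-1 = trans (neg x z) (-‿cong xz≈1)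

  *-pos : ∀ {x y} → 0# < x → 0# < y → 0# < x * y
  *-pos {x} {y} 0<x 0<y xy≤0 =
    0<y (0≤-x⇒x≤0 (*-cancelˡ-nonneg 0<x (≤-respʳ (neg x y) (x≤0⇒0≤-x xy≤0))))
    where
    neg : ∀ x y → - (x * y) ≈ x * (- y)
    neg = solve 2 (λ x y → :- (x :* y) := x :* (:- y)) refl

  -- Determinants

  Mat : ℕ → Set c
  Mat k = Fin k → Fin k → Carrier

  altSum-cong : ∀ {k} (f g : Fin k → Carrier) → (∀ i → f i ≈ g i) → altSum F f ≈ altSum F g
  altSum-cong {ℕ.zero} f g f≈g = refl
  altSum-cong {suc k}  f g f≈g =
    +-cong (f≈g zero) (-‿cong (altSum-cong (f ∘ suc) (g ∘ suc) (f≈g ∘ suc)))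

  altSum-zero : ∀ {k} (f : Fin k → Carrier) → (∀ i → f i ≈ 0#) → altSum F f ≈ 0#
  altSum-zero {ℕ.zero} f f≈0 = refl
  altSum-zero {suc k}  f f≈0 =
    trans (+-cong (f≈0 zero) (-‿cong (altSum-zero (f ∘ suc) (f≈0 ∘ suc)))) (-‿inverseʳ 0#)

  altSum-linear : ∀ {k} u (f g : Fin k → Carrier) →
    altSum F (λ i → f i + u * g i) ≈ altSum F f + u * altSum F g
  altSum-linear {ℕ.zero} u f g = base u
    where
    base : ∀ u → 0# ≈ 0# + u * 0#
    base = solve 1 (λ u → con (+ 0) := con (+ 0) :+ u :* con (+ 0)) refl
  altSum-linear {suc k} u f g =
    trans (+-congˡ (-‿cong (altSum-linear u (f ∘ suc) (g ∘ suc)))) (step (f zero) u (g zero) _ _)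
    where
    step : ∀ x u y s t → x + u * y - (s + u * t) ≈ (x - s) + u * (y - t)
    step = solve 5 (λ x u y s t → x :+ u :* y :- (s :+ u :* t) := (x :- s) :+ u :* (y :- t)) refl

  minor : ∀ {k} → Mat (suc k) → Fin (suc k) → Mat k
  minor A j r s = A (suc r) (punchIn j s)

  laplaceTerm : ∀ {k} → Mat (suc k) → Fin (suc k) → Carrier
  laplaceTerm A j = A zero j * det F (minor A j)

  det-cong : ∀ {k} {A B : Mat k} → (∀ i j → A i j ≈ B i j) → det F A ≈ det F B
  det-cong {ℕ.zero}  A≈B = refl
  det-cong {suc k} {A} {B} A≈B = altSum-cong (laplaceTerm A) (laplaceTerm B)
    (λ j → *-cong (A≈B zero j) (det-cong {k} {minor A j} {minor B j} (λ r s → A≈B (suc r) (punchIn j s))))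

  -- Induction along the Laplace expansion. For p = 0 the three matrices have the same minors below
  -- the top row; otherwise their top rows agree and the minors satisfy the hypotheses again.
  det-linear : ∀ {k} (p : Fin k) u (A B C : Mat k) →
    (∀ j → A p j ≈ B p j + u * C p j) →
    (∀ i → i ≢ p → ∀ j → A i j ≈ B i j) → (∀ i → i ≢ p → ∀ j → C i j ≈ B i j) →
    det F A ≈ det F B + u * det F C
  det-linear {suc k} p u A B C row A≈B C≈B = trans
    (altSum-cong (laplaceTerm A) (λ j → laplaceTerm B j + u * laplaceTerm C j) (term p row A≈B C≈B))
    (altSum-linear u (laplaceTerm B) (laplaceTerm C))
    where
    term : ∀ p → (∀ j → A p j ≈ B p j + u * C p j) →
      (∀ i → i ≢ p → ∀ j → A i j ≈ B i j) → (∀ i → i ≢ p → ∀ j → C i j ≈ B i j) →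
      ∀ j → laplaceTerm A j ≈ laplaceTerm B j + u * laplaceTerm C j
    term zero row A≈B C≈B j = begin
      A zero j * det F (minor A j)
        ≈⟨ *-cong (row j) (det-cong (λ r s → A≈B (suc r) (λ ()) _)) ⟩
      (B zero j + u * C zero j) * det F (minor B j)
        ≈⟨ expand (B zero j) u (C zero j) _ ⟩
      B zero j * det F (minor B j) + u * (C zero j * det F (minor B j))
        ≈⟨ +-congˡ (*-congˡ (*-congˡ (det-cong (λ r s → sym (C≈B (suc r) (λ ()) _))))) ⟩
      B zero j * det F (minor B j) + u * (C zero j * det F (minor C j)) ∎
      where
      expand : ∀ b u c D → (b + u * c) * D ≈ b * D + u * (c * D)
      expand = solve 4 (λ b u c D → (b :+ u :* c) :* D := b :* D :+ u :* (c :* D)) refl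
    term (suc p) row A≈B C≈B j = begin
      A zero j * det F (minor A j)
        ≈⟨ *-cong (A≈B zero (λ ()) j) (det-linear p u (minor A j) (minor B j) (minor C j) (λ s → row _)
             (λ i i≢p s → A≈B (suc i) (suc≢ i≢p) _) (λ i i≢p s → C≈B (suc i) (suc≢ i≢p) _)) ⟩
      B zero j * (det F (minor B j) + u * det F (minor C j))
        ≈⟨ expand (B zero j) u _ _ ⟩
      B zero j * det F (minor B j) + u * (B zero j * det F (minor C j))
        ≈⟨ +-congˡ (*-congˡ (*-congʳ (sym (C≈B zero (λ ()) j)))) ⟩
      B zero j * det F (minor B j) + u * (C zero j * det F (minor C j)) ∎
      where
      expand : ∀ b u D E → b * (D + u * E) ≈ b * D + u * (b * E)
      expand = solve 4 (λ b u D E → b :* (D :+ u :* E) := b :* D :+ u :* (b :* E)) refl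
      suc≢ : ∀ {i} → i ≢ p → suc i ≢ suc p
      suc≢ i≢p = i≢p ∘ Fin.suc-injective

  -- Deleting column j and then column l of the rest, or the same two columns in the other order,
  -- leaves the same complementary minor but with opposite signs.
  altSum-altSum-zero : ∀ {k} (v : Fin (suc (suc k)) → Carrier) (D : (Fin k → Fin (suc (suc k))) → Carrier) →
    (∀ f g → (∀ s → f s ≡ g s) → D f ≈ D g) →
    altSum F (λ j → v j * altSum F (λ l → v (punchIn j l) * D (λ s → punchIn j (punchIn l s)))) ≈ 0#
  altSum-altSum-zero {k} v D D-cong = begin
    -- Column 0 is deleted either first (j = 0) or second (l = 0). Both choices give
    -- `v zero * altSum F front`, with opposite signs; `back` collects the pairs that keep column 0.
    v zero * altSum F front - altSum F (λ j → v (suc j) * (v zero * D (λ s → suc (punchIn j s)) - rest j))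
      ≈⟨ +-congˡ (-‿cong (altSum-cong
           (λ j → v (suc j) * (v zero * D (λ s → suc (punchIn j s)) - rest j))
           (λ j → (0# + - 1# * back j) + v zero * front j)
           (λ j → split (v (suc j)) (v zero) (D (λ s → suc (punchIn j s))) (rest j)))) ⟩
    v zero * altSum F front - altSum F (λ j → (0# + - 1# * back j) + v zero * front j)
      ≈⟨ +-congˡ (-‿cong (trans (altSum-linear (v zero) (λ j → 0# + - 1# * back j) front)
           (+-congʳ (altSum-linear (- 1#) (λ _ → 0#) back)))) ⟩
    v zero * altSum F front - (altSum F 0s + - 1# * altSum F back + v zero * altSum F front)
      ≈⟨ collapse (v zero * altSum F front) (altSum F 0s) (altSum F back) ⟩
    altSum F back - altSum F 0s
      ≈⟨ +-cong (back-zero k v D D-cong) (-‿cong (altSum-zero 0s (λ _ → refl))) ⟩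
    0# - 0#
      ≈⟨ -‿inverseʳ 0# ⟩
    0# ∎
    where
    0s front rest back : Fin (suc k) → Carrier
    0s _ = 0#
    front l = v (suc l) * D (λ s → suc (punchIn l s))
    rest j = altSum F (λ l → v (suc (punchIn j l)) * D (λ s → punchIn (suc j) (punchIn (suc l) s)))
    back j = v (suc j) * rest j
    split : ∀ x y z w → x * (y * z - w) ≈ (0# + - 1# * (x * w)) + y * (x * z)
    split = solve 4 (λ x y z w →
      x :* (y :* z :- w) := (con (+ 0) :+ :- con (+ 1) :* (x :* w)) :+ y :* (x :* z)) refl
    collapse : ∀ x z y → x - (z + - 1# * y + x) ≈ y - z
    collapse = solve 3 (λ x z y → x :- (z :+ :- con (+ 1) :* y :+ x) := y :- z) refl
    back-zero : ∀ k (v : Fin (suc (suc k)) → Carrier) (D : (Fin k → Fin (suc (suc k))) → Carrier) →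
      (∀ f g → (∀ s → f s ≡ g s) → D f ≈ D g) →
      altSum F {suc k} (λ j → v (suc j) * altSum F {k} (λ l → v (suc (punchIn j l)) *
        D (λ s → punchIn (suc j) (punchIn (suc l) s)))) ≈ 0#
    back-zero ℕ.zero v D D-cong = altSum-zero {1} (λ j → v (suc j) * 0#) (λ _ → zeroʳ _)
    -- Column 0 survives, so each index map fixes 0 and is a `lift` of one on the remaining columns.
    -- Absorbing the `lift` into `D` gives the same claim for `v ∘ suc`.
    back-zero (suc k) v D D-cong = trans
      (altSum-cong {suc (suc k)} (λ j → v (suc j) * altSum F (inner j)) (λ j → v (suc j) * altSum F (inner′ j))
        (λ j → *-congˡ (altSum-cong {suc k} (inner j) (inner′ j) (λ l → *-congˡ (D-cong _ _ (λ where
          zero → ≡.refl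
          (suc s) → ≡.refl))))))
      (altSum-altSum-zero (v ∘ suc) (D ∘ Fin.lift 1)
        (λ f g f≗g → D-cong (Fin.lift 1 f) (Fin.lift 1 g) (λ where
          zero → ≡.refl
          (suc s) → ≡.cong suc (f≗g s))))
      where
      inner inner′ : Fin (suc (suc k)) → Fin (suc k) → Carrier
      inner  j l = v (suc (punchIn j l)) * D (λ s → punchIn (suc j) (punchIn (suc l) s))
      inner′ j l = v (suc (punchIn j l)) * D (Fin.lift 1 (λ s → punchIn j (punchIn l s)))

  -- If the top two rows agree, expanding along both gives the double sum of `altSum-altSum-zero`.
  -- Otherwise every minor of the Laplace expansion contains the equal rows.
  det-repeat : ∀ {k} (q : Fin k) (A : Mat (suc k)) → (∀ j → A (inject₁ q) j ≈ A (suc q) j) → det F A ≈ 0#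
  det-repeat {suc k} zero A rows = trans
    (altSum-cong {suc (suc k)} (laplaceTerm A) (λ j → A (suc zero) j * det F (minor A j)) (λ j → *-congʳ (rows j)))
    (altSum-altSum-zero (A (suc zero)) (λ f → det F (λ r s → A (suc (suc r)) (f s)))
      (λ f g f≗g → det-cong (λ r s → reflexive (≡.cong (A (suc (suc r))) (f≗g s)))))
  det-repeat {suc k} (suc q) A rows = altSum-zero {suc (suc k)} (laplaceTerm A)
    (λ j → trans (*-congˡ (det-repeat q (minor A j) (λ s → rows (punchIn j s)))) (zeroʳ (A zero j)))

  -- A minor that omits a later column still contains column 0, which is zero below the top row, so
  -- it vanishes by the same statement for smaller matrices.
  det-firstCol : ∀ {k} (A : Mat (suc k)) → (∀ i → A (suc i) zero ≈ 0#) →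
    det F A ≈ A zero zero * det F (λ r s → A (suc r) (suc s))
  det-firstCol {k} A col = trans
    (+-congˡ (-‿cong (altSum-zero (laplaceTerm A ∘ suc)
      (λ j → trans (*-congˡ (minor-zero k A col j)) (zeroʳ (A zero (suc j)))))))
    (x-0≈x (laplaceTerm A zero))
    where
    x-0≈x : ∀ x → x - 0# ≈ x
    x-0≈x = solve 1 (λ x → x :- con (+ 0) := x) refl
    minor-zero : ∀ k (A : Mat (suc k)) → (∀ i → A (suc i) zero ≈ 0#) →
      ∀ j → det F (minor A (suc j)) ≈ 0#
    minor-zero (suc k) A col j = trans
      (det-firstCol (minor A (suc j)) (λ i → col (suc i)))
      (trans (*-congʳ (col zero)) (zeroˡ _))

  det-zeroCol : ∀ {k} (A : Mat (suc k)) → (∀ i → A i zero ≈ 0#) → det F A ≈ 0#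
  det-zeroCol A col = trans (det-firstCol A (λ i → col (suc i))) (trans (*-congʳ (col zero)) (zeroˡ _))

  det-zeroRow : ∀ {k} (A : Mat (suc k)) → (∀ j → A zero j ≈ 0#) → det F A ≈ 0#
  det-zeroRow A row = altSum-zero (laplaceTerm A) (λ j → trans (*-congʳ (row j)) (zeroˡ _))

  -- Row operations and total non-negativity

  pred-mono : ∀ {k n} (r : Fin k → Fin (suc n)) → StrictlyIncreasing F r → (∀ i → r i ≢ zero) →
    Σ (Fin k → Fin n) λ r′ → StrictlyIncreasing F r′ × (∀ i → r i ≡ suc (r′ i))
  pred-mono r r-mono r≢0 = r′ , r′-mono , r≡
    where
    pred : ∀ {n} (x : Fin (suc n)) → x ≢ zero → ∃ λ y → x ≡ suc y
    pred zero x≢0 = contradiction ≡.refl x≢0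
    pred (suc y) _ = y , ≡.refl
    r′ = λ i → proj₁ (pred (r i) (r≢0 i))
    r≡ = λ i → proj₂ (pred (r i) (r≢0 i))
    r′-mono : StrictlyIncreasing F r′
    r′-mono i j i<j = ℕ.s<s⁻¹ (≡.subst₂ Fin._<_ (r≡ i) (r≡ j) (r-mono i j i<j))

  -- Row 0 holds the coordinates of P_0 = 1. Row m + 1 holds those of (x - a₁) P′_m: multiplying by
  -- x - a₁ shifts the coordinates by one place and leaves 0 in front.
  1⊕_ : ∀ {n} → Mat n → Mat (suc n)
  (1⊕ N) zero    zero    = 1#
  (1⊕ N) zero    (suc j) = 0#
  (1⊕ N) (suc i) zero    = 0#
  (1⊕ N) (suc i) (suc j) = N i j

  1⊕-firstCol : ∀ {n} (N : Mat n) i → i ≢ zero → (1⊕ N) i zero ≈ 0#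
  1⊕-firstCol N zero i≢0 = contradiction ≡.refl i≢0
  1⊕-firstCol N (suc i) _ = refl

  1⊕-firstRow : ∀ {n} (N : Mat n) j → j ≢ zero → (1⊕ N) zero j ≈ 0#
  1⊕-firstRow N zero j≢0 = contradiction ≡.refl j≢0
  1⊕-firstRow N (suc j) _ = refl

  0<⇒≢zero : ∀ {n} {x y : Fin (suc n)} → x Fin.< y → y ≢ zero
  0<⇒≢zero () ≡.refl

  tail-mono : ∀ {k n} {r : Fin (suc k) → Fin n} → StrictlyIncreasing F r → StrictlyIncreasing F (r ∘ suc)
  tail-mono r-mono i j i<j = r-mono (suc i) (suc j) (s≤s i<j)

  1⊕-minor-nonneg : ∀ {n} (N : Mat n) → TotallyNonNegative F N → ∀ {k} (r s : Fin k → Fin (suc n)) →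
    StrictlyIncreasing F r → StrictlyIncreasing F s → (∀ i → r i ≢ zero) → (∀ i → s i ≢ zero) →
    0# ≤ det F (λ i j → (1⊕ N) (r i) (s j))
  1⊕-minor-nonneg N N-tnn {k} r s r-mono s-mono r≢0 s≢0 with pred-mono r r-mono r≢0 | pred-mono s s-mono s≢0
  ... | r′ , r′-mono , r≡ | s′ , s′-mono , s≡ = ≤-respʳ
    (det-cong (λ i j → reflexive (≡.sym (≡.cong₂ (1⊕ N) (r≡ i) (s≡ j)))))
    (N-tnn k r′ s′ r′-mono s′-mono)

  suc-head⇒≢zero : ∀ {k n} {r : Fin (suc k) → Fin (suc n)} {x} → StrictlyIncreasing F r → r zero ≡ suc x →
    ∀ i → r i ≢ zero
  suc-head⇒≢zero r-mono r₀ zero ri≡0 = contradiction (≡.trans (≡.sym r₀) ri≡0) λ ()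
  suc-head⇒≢zero r-mono r₀ (suc i) = 0<⇒≢zero (r-mono zero (suc i) (s≤s z≤n))

  -- A minor using both row 0 and column 0 reduces to a minor of `N` by expansion along column 0.
  -- Using just one of them it has a zero row or column, and using neither it is a minor of `N`.
  1⊕-TotallyNonNegative : ∀ {n} (N : Mat n) → TotallyNonNegative F N → TotallyNonNegative F (1⊕ N)
  1⊕-TotallyNonNegative N N-tnn ℕ.zero r s r-mono s-mono = 0≤1
  1⊕-TotallyNonNegative N N-tnn (suc k) r s r-mono s-mono = cases (r zero) (s zero) ≡.refl ≡.refl
    where
    A : Mat (suc k)
    A i j = (1⊕ N) (r i) (s j)
    col : s zero ≡ zero → ∀ i → r i ≢ zero → A i zero ≈ 0#
    col s₀ i ri≢0 = trans (reflexive (≡.cong ((1⊕ N) (r i)) s₀)) (1⊕-firstCol N (r i) ri≢0)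
    cases : ∀ x y → r zero ≡ x → s zero ≡ y → 0# ≤ det F A
    cases zero zero r₀ s₀ = ≤-respʳ
      (sym (trans (det-firstCol A (λ i → col s₀ (suc i) (r≢0 i)))
        (trans (*-congʳ (reflexive (≡.cong₂ (1⊕ N) r₀ s₀))) (*-identityˡ _))))
      (1⊕-minor-nonneg N N-tnn (r ∘ suc) (s ∘ suc) (tail-mono r-mono) (tail-mono s-mono) r≢0
        (λ j → 0<⇒≢zero (s-mono zero (suc j) (s≤s z≤n))))
      where
      r≢0 : ∀ i → r (suc i) ≢ zero
      r≢0 i = 0<⇒≢zero (r-mono zero (suc i) (s≤s z≤n))
    cases zero (suc _) r₀ s₀ = ≤.reflexive (sym (det-zeroRow A (λ j →
      trans (reflexive (≡.cong (λ x → (1⊕ N) x (s j)) r₀)) (1⊕-firstRow N (s j) (suc-head⇒≢zero s-mono s₀ j)))))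
    cases (suc _) zero r₀ s₀ = ≤.reflexive (sym (det-zeroCol A (λ i → col s₀ i (suc-head⇒≢zero r-mono r₀ i))))
    cases (suc _) (suc _) r₀ s₀ =
      1⊕-minor-nonneg N N-tnn r s r-mono s-mono (suc-head⇒≢zero r-mono r₀) (suc-head⇒≢zero s-mono s₀)

  -- Increasing index maps

  mono-≤ : ∀ {k n} {r : Fin k → Fin n} → StrictlyIncreasing F r → ∀ i j → i Fin.≤ j → r i Fin.≤ r j
  mono-≤ {r = r} r-mono i j i≤j with ℕ.m≤n⇒m<n∨m≡n i≤j
  ... | inj₁ i<j = ℕ.<⇒≤ (r-mono i j i<j)
  ... | inj₂ i≡j = ℕ.≤-reflexive (≡.cong (toℕ ∘ r) (Fin.toℕ-injective i≡j))

  mono-≢ : ∀ {k n} {r : Fin k → Fin n} → StrictlyIncreasing F r → ∀ i j → i ≢ j → toℕ (r i) ≢ toℕ (r j)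
  mono-≢ {r = r} r-mono i j i≢j ri≡rj with ℕ.<-cmp (toℕ i) (toℕ j)
  ... | tri< i<j _ _ = ℕ.<⇒≢ (r-mono i j i<j) ri≡rj
  ... | tri≈ _ i≡j _ = i≢j (Fin.toℕ-injective i≡j)
  ... | tri> _ _ j<i = ℕ.<⇒≢ (r-mono j i j<i) (≡.sym ri≡rj)

  updateAt-mono : ∀ {k n} (r : Fin k → Fin n) p x → StrictlyIncreasing F r → x Fin.< r p →
    (∀ i → i Fin.< p → r i Fin.< x) → StrictlyIncreasing F (updateAt r p (const x))
  updateAt-mono r p x r-mono x<rp below i j i<j with i Fin.≟ p | j Fin.≟ p
  ... | yes ≡.refl | yes ≡.refl = contradiction i<j (ℕ.<-irrefl ≡.refl)
  ... | yes ≡.refl | no j≢p = ≡.subst₂ Fin._<_ (≡.sym (updateAt-updates p r)) (≡.sym (updateAt-minimal j p r j≢p))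
    (ℕ.<-trans x<rp (r-mono p j i<j))
  ... | no i≢p | yes ≡.refl = ≡.subst₂ Fin._<_ (≡.sym (updateAt-minimal i p r i≢p)) (≡.sym (updateAt-updates p r))
    (below i i<j)
  ... | no i≢p | no j≢p = ≡.subst₂ Fin._<_ (≡.sym (updateAt-minimal i p r i≢p)) (≡.sym (updateAt-minimal j p r j≢p))
    (r-mono i j i<j)

  -- The rows are b, b + 1, ..., while the columns are arbitrary. Since `r` maps into `Fin n`, the
  -- block of rows fits into the matrix by its type.
  ConsecutiveRowMinorsNonNegative : ∀ {n} → Mat n → Set ℓ₂
  ConsecutiveRowMinorsNonNegative {n} M = ∀ k b (r s : Fin k → Fin n) → (∀ i → toℕ (r i) ≡ b ℕ.+ toℕ i) →
    StrictlyIncreasing F s → 0# ≤ det F (λ i j → M (r i) (s j))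

  TotallyNonNegative⇒consecutive : ∀ {n} (M : Mat n) → TotallyNonNegative F M → ConsecutiveRowMinorsNonNegative M
  TotallyNonNegative⇒consecutive M M-tnn k b r s r≡ s-mono = M-tnn k r s
    (λ i j i<j → ≡.subst₂ ℕ._<_ (≡.sym (r≡ i)) (≡.sym (r≡ j)) (ℕ.+-monoʳ-< b i<j)) s-mono

  -- `next` refers to the preceding row of `M`, not of `K`. So `M` arises from `K` by operations
  -- carried out from the top down, each adding a multiple of the row just completed to the next
  -- one.
  module RowRecurrence {n : ℕ} (M K : Mat (suc n)) (d : ℕ → Carrier)
    (first : ∀ j → M zero j ≈ K zero j)
    (next : ∀ m j → M (suc m) j ≈ K (suc m) j + d (toℕ m) * M (inject₁ m) j) where

    -- hybrid (suc t) arises from hybrid t by a single row operation.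
    hybrid : ℕ → Mat (suc n)
    hybrid t i j = if does (toℕ i ℕ.≤? t) then M i j else K i j

    hybrid-≤ : ∀ {t i} j → toℕ i ℕ.≤ t → hybrid t i j ≡ M i j
    hybrid-≤ {t} {i} j i≤t = ≡.cong (if_then M i j else K i j) (dec-true (toℕ i ℕ.≤? t) i≤t)

    hybrid-> : ∀ {t i} j → ¬ (toℕ i ℕ.≤ t) → hybrid t i j ≡ K i j
    hybrid-> {t} {i} j i≰t = ≡.cong (if_then M i j else K i j) (dec-false (toℕ i ℕ.≤? t) i≰t)

    hybrid-unchanged : ∀ {t i} j → toℕ i ≢ suc t → hybrid (suc t) i j ≡ hybrid t i j
    hybrid-unchanged {t} {i} j i≢1+t with toℕ i ℕ.≤? t
    ... | yes i≤t = ≡.trans (hybrid-≤ {suc t} {i} j (ℕ.m≤n⇒m≤1+n i≤t)) (≡.sym (hybrid-≤ {t} {i} j i≤t))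
    ... | no  i≰t = ≡.trans (hybrid-> {suc t} {i} j (λ i≤1+t → i≰t (ℕ.s≤s⁻¹ (ℕ.≤∧≢⇒< i≤1+t i≢1+t)))) (≡.sym (hybrid-> {t} {i} j i≰t))

    hybrid-0 : ∀ i j → K i j ≈ hybrid 0 i j
    hybrid-0 zero    j = sym (first j)
    hybrid-0 (suc i) j = refl

    hybridMinor : ∀ {k} → ℕ → (r s : Fin k → Fin (suc n)) → Carrier
    hybridMinor t r s = det F (λ i j → hybrid t (r i) (s j))

    hybridMinor-absent : ∀ {k} t (r s : Fin k → Fin (suc n)) → (∀ i → toℕ (r i) ≢ suc t) →
      hybridMinor (suc t) r s ≈ hybridMinor t r s
    hybridMinor-absent t r s absent = det-cong (λ i j → reflexive (hybrid-unchanged (s j) (absent i)))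

    -- Linearity in row `p`, the only selected row that the operation changes: the correction term
    -- selects row t in place of row t + 1.
    hybridMinor-present : ∀ {k} t (r s : Fin k → Fin (suc n)) p m → r p ≡ suc m → toℕ m ≡ t →
      (∀ i → i ≢ p → toℕ (r i) ≢ toℕ (r p)) →
      hybridMinor (suc t) r s ≈ hybridMinor t r s + d t * hybridMinor t (updateAt r p (const (inject₁ m))) s
    hybridMinor-present t r s p m rp≡ ≡.refl r-inj = det-linear p (d t) _ _ _
      (λ j → row (s j))
      (λ i i≢p j → reflexive (hybrid-unchanged (s j) (λ ri≡ → r-inj i i≢p (≡.trans ri≡ (≡.sym (≡.cong toℕ rp≡))))))
      (λ i i≢p j → reflexive (≡.cong (λ x → hybrid t x (s j)) (updateAt-minimal i p r i≢p)))
      where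
      row : ∀ j → hybrid (suc t) (r p) j ≈
        hybrid t (r p) j + d t * hybrid t (updateAt r p (const (inject₁ m)) p) j
      row j = begin
        hybrid (suc t) (r p) j
          ≡⟨ ≡.cong (λ x → hybrid (suc t) x j) rp≡ ⟩
        hybrid (suc t) (suc m) j
          ≡⟨ hybrid-≤ j ℕ.≤-refl ⟩
        M (suc m) j
          ≈⟨ next m j ⟩
        K (suc m) j + d t * M (inject₁ m) j
          ≡⟨ ≡.cong₂ (λ x y → x + d t * y) (hybrid-> j ℕ.1+n≰n) (hybrid-≤ j (ℕ.≤-reflexive (Fin.toℕ-inject₁ m))) ⟨
        hybrid t (suc m) j + d t * hybrid t (inject₁ m) j
          ≡⟨ ≡.cong₂ (λ x y → hybrid t x j + d t * hybrid t y j) rp≡ (updateAt-updates p r) ⟨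
        hybrid t (r p) j + d t * hybrid t (updateAt r p (const (inject₁ m)) p) j ∎

    -- After the replacement the adjacent positions `inject₁ q` and `suc q` both select row `x`.
    hybridMinor-repeat : ∀ {k} t (r s : Fin (suc k) → Fin (suc n)) q x → r (inject₁ q) ≡ x →
      hybridMinor t (updateAt r (suc q) (const x)) s ≈ 0#
    hybridMinor-repeat t r s q x rq≡x = det-repeat q
      (λ i j → hybrid t (updateAt r (suc q) (const x) i) (s j)) (λ j → reflexive (≡.cong (λ y → hybrid t y (s j))
      (≡.trans (updateAt-minimal (inject₁ q) (suc q) r (λ q≡1+q → ℕ.1+n≢n
          (≡.trans (≡.sym (≡.cong toℕ q≡1+q)) (Fin.toℕ-inject₁ q))))
        (≡.trans rq≡x (≡.sym (updateAt-updates (suc q) r))))))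

    toℕ≡suc⇒≡suc : ∀ {t} (x : Fin (suc n)) → toℕ x ≡ suc t → ∃ λ m → x ≡ suc m × toℕ m ≡ t
    toℕ≡suc⇒≡suc (suc m) ≡.refl = m , ≡.refl , ≡.refl

    -- Induction on the number of row operations. A minor selecting row t + 1 gains `d t` times a
    -- minor of the previous matrix, which either repeats row t or again has increasing rows.
    hybrid-TotallyNonNegative : (∀ m → 0# ≤ d m) → TotallyNonNegative F K →
      ∀ t → TotallyNonNegative F (hybrid t)
    hybrid-TotallyNonNegative 0≤d K-tnn ℕ.zero k r s r-mono s-mono =
      ≤-respʳ (det-cong (λ i j → hybrid-0 (r i) (s j))) (K-tnn k r s r-mono s-mono)
    hybrid-TotallyNonNegative 0≤d K-tnn (suc t) k r s r-mono s-mono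
      with Fin.any? (λ i → toℕ (r i) ℕ.≟ suc t)
    ... | no absent = ≤-respʳ (sym (hybridMinor-absent t r s (λ i ri≡ → absent (i , ri≡))))
      (hybrid-TotallyNonNegative 0≤d K-tnn t k r s r-mono s-mono)
    ... | yes (p , rp≡1+t) with toℕ≡suc⇒≡suc (r p) rp≡1+t
    ...   | m , rp≡ , m≡t = ≤-respʳ
      (sym (hybridMinor-present t r s p m rp≡ m≡t (λ i → mono-≢ r-mono i p)))
      (+-nonneg (hybrid-TotallyNonNegative 0≤d K-tnn t k r s r-mono s-mono)
        (*-nonneg (0≤d t) (replaced r p r-mono s-mono rp≡)))
      where
      m′≡t : toℕ (inject₁ m) ≡ t
      m′≡t = ≡.trans (Fin.toℕ-inject₁ m) m≡t

      increasing : ∀ {k} (r : Fin k → Fin (suc n)) p → StrictlyIncreasing F r → r p ≡ suc m →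
        (∀ i → i Fin.< p → r i Fin.< inject₁ m) →
        StrictlyIncreasing F (updateAt r p (const (inject₁ m)))
      increasing r p r-mono rp≡ = updateAt-mono r p (inject₁ m) r-mono
        (ℕ.≤-reflexive (≡.trans (≡.cong suc (Fin.toℕ-inject₁ m)) (≡.sym (≡.cong toℕ rp≡))))

      replaced : ∀ {k} {s : Fin k → Fin (suc n)} (r : Fin k → Fin (suc n)) p →
        StrictlyIncreasing F r → StrictlyIncreasing F s → r p ≡ suc m →
        0# ≤ hybridMinor t (updateAt r p (const (inject₁ m))) s
      replaced {s = s} r zero r-mono s-mono rp≡ =
        hybrid-TotallyNonNegative 0≤d K-tnn t _ _ s (increasing r zero r-mono rp≡ (λ _ ())) s-mono
      -- The selected row just above lies below t + 1 in index. If it is t, the replacement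
      -- duplicates it; otherwise it is smaller than t and the rows stay increasing.
      replaced {s = s} r (suc q) r-mono s-mono rp≡ with toℕ (r (inject₁ q)) ℕ.≟ t
      ... | yes rq≡t = ≤.reflexive (sym (hybridMinor-repeat t r s q (inject₁ m)
        (Fin.toℕ-injective (≡.trans rq≡t (≡.sym m′≡t)))))
      ... | no  rq≢t = hybrid-TotallyNonNegative 0≤d K-tnn t _ _ s
        (increasing r (suc q) r-mono rp≡ (λ i i<p → ℕ.≤-<-trans
          (mono-≤ r-mono i (inject₁ q) (ℕ.≤-trans (ℕ.s≤s⁻¹ i<p) (ℕ.≤-reflexive (≡.sym (Fin.toℕ-inject₁ q)))))
          (≡.subst (toℕ (r (inject₁ q)) ℕ.<_) (≡.sym m′≡t) (ℕ.≤∧≢⇒< rq≤t rq≢t))))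
        s-mono
        where
        rq≤t : toℕ (r (inject₁ q)) ℕ.≤ t
        rq≤t = ℕ.s≤s⁻¹ (≡.subst (toℕ (r (inject₁ q)) ℕ.<_) (≡.trans (≡.cong toℕ rp≡) (≡.cong suc m≡t))
          (r-mono (inject₁ q) (suc q) (s≤s (ℕ.≤-reflexive (Fin.toℕ-inject₁ q)))))

    M-TotallyNonNegative : (∀ m → 0# ≤ d m) → TotallyNonNegative F K → TotallyNonNegative F M
    M-TotallyNonNegative 0≤d K-tnn k r s r-mono s-mono = ≤-respʳ
      -- All row indices are at most n, so `hybrid n` agrees with `M`.
      (det-cong (λ i j → reflexive (hybrid-≤ (s j) (ℕ.s≤s⁻¹ (Fin.toℕ<n (r i))))))
      (hybrid-TotallyNonNegative 0≤d K-tnn n k r s r-mono s-mono)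

    -- If row t + 1 belongs to a block of consecutive rows starting at b ≤ t, then so does row t,
    -- directly above it. The correction term therefore has two equal rows.
    hybridMinor-consecutive-suc : ∀ {k} b t (r s : Fin (suc k) → Fin (suc n)) → (∀ i → toℕ (r i) ≡ b ℕ.+ toℕ i) →
      b ℕ.≤ t → hybridMinor (suc t) r s ≈ hybridMinor t r s
    hybridMinor-consecutive-suc b t r s r≡ b≤t with Fin.any? (λ i → toℕ (r i) ℕ.≟ suc t)
    ... | no absent = hybridMinor-absent t r s (λ i ri≡ → absent (i , ri≡))
    ... | yes (zero , r0≡1+t) = contradiction
      (ℕ.≤-trans (ℕ.≤-reflexive (≡.trans (≡.sym r0≡1+t) (≡.trans (r≡ zero) (ℕ.+-identityʳ b)))) b≤t) ℕ.1+n≰n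
    ... | yes (suc q , rp≡1+t) with toℕ≡suc⇒≡suc (r (suc q)) rp≡1+t
    ...   | m , rp≡ , m≡t = trans
      (hybridMinor-present t r s (suc q) m rp≡ m≡t (λ i i≢p ri≡rp → i≢p (Fin.toℕ-injective
        (ℕ.+-cancelˡ-≡ b (toℕ i) (suc (toℕ q)) (≡.trans (≡.sym (r≡ i)) (≡.trans ri≡rp (r≡ (suc q))))))))
      (trans (+-congˡ (trans (*-congˡ (hybridMinor-repeat t r s q (inject₁ m) rq≡m)) (zeroʳ _))) (+-identityʳ _))
      where
      rq≡m : r (inject₁ q) ≡ inject₁ m
      rq≡m = Fin.toℕ-injective (≡.trans (r≡ (inject₁ q)) (≡.trans (≡.cong (b ℕ.+_) (Fin.toℕ-inject₁ q))
        (≡.trans (ℕ.suc-injective (≡.trans (≡.sym (ℕ.+-suc b (toℕ q))) (≡.trans (≡.sym (r≡ (suc q))) rp≡1+t)))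
          (≡.sym (≡.trans (Fin.toℕ-inject₁ m) m≡t)))))

    hybridMinor-consecutive : ∀ {k} b u (r s : Fin (suc k) → Fin (suc n)) → (∀ i → toℕ (r i) ≡ b ℕ.+ toℕ i) →
      hybridMinor (u ℕ.+ b) r s ≈ hybridMinor b r s
    hybridMinor-consecutive b ℕ.zero r s r≡ = refl
    hybridMinor-consecutive b (suc u) r s r≡ = trans
      (hybridMinor-consecutive-suc b (u ℕ.+ b) r s r≡ (ℕ.m≤n+m b u)) (hybridMinor-consecutive b u r s r≡)

    -- All operations on rows below b are undone: in `hybrid b` the block consists of row b of `M`
    -- followed by rows of `K`. Starting from n + b ensures that every row is initially a row of
    -- `M`.
    M-minor-consecutive : ∀ {k} b (r s : Fin (suc k) → Fin (suc n)) → (∀ i → toℕ (r i) ≡ b ℕ.+ toℕ i) →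
      det F (λ i j → M (r i) (s j)) ≈ hybridMinor b r s
    M-minor-consecutive b r s r≡ = trans
      (det-cong (λ i j → reflexive (≡.sym (hybrid-≤ (s j) (ℕ.≤-trans (ℕ.s≤s⁻¹ (Fin.toℕ<n (r i))) (ℕ.m≤m+n n b))))))
      (hybridMinor-consecutive b n r s r≡)

  -- Passing between the minors of M and of N

  lift-mono : ∀ {k n} {s : Fin k → Fin n} → StrictlyIncreasing F s → StrictlyIncreasing F (Fin.lift 1 s)
  lift-mono s-mono zero    (suc j) _   = s≤s z≤n
  lift-mono s-mono (suc i) (suc j) i<j = s≤s (s-mono i j (ℕ.s<s⁻¹ i<j))

  -- Stated as an alternative at every index because a minor starting in row b uses it at b: either
  -- M b 0 is positive, or the weights vanish from b on.
  PositiveThenZero : (ℕ → Carrier) → Set _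
  PositiveThenZero d = ∀ m → (∀ i → i ℕ.< m → 0# < d i) ⊎ (∀ i → m ℕ.≤ i → d i ≈ 0#)

  module _ {n : ℕ} (M : Mat (suc n)) (N : Mat n) (d : ℕ → Carrier)
    (first : ∀ j → M zero j ≈ (1⊕ N) zero j)
    (next : ∀ m j → M (suc m) j ≈ (1⊕ N) (suc m) j + d (toℕ m) * M (inject₁ m) j) where

    open RowRecurrence M (1⊕ N) d first next

    next-firstCol : ∀ m → M (suc m) zero ≈ d (toℕ m) * M (inject₁ m) zero
    next-firstCol m = trans (next m zero) (+-identityˡ _)

    -- The entry is the product of the weights before `i`, starting from M 0 0 = 1.
    firstCol-pos : ∀ i → (∀ m → m ℕ.< toℕ i → 0# < d m) → 0# < M i zero
    firstCol-pos = <-weakInduction (λ i → (∀ m → m ℕ.< toℕ i → 0# < d m) → 0# < M i zero)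
      (λ _ M≤0 → 0<1 (≤.≤-respˡ-≈ (first zero) M≤0))
      (λ m ih 0<d M≤0 → *-pos (0<d (toℕ m) ℕ.≤-refl)
        (ih (λ i i<m → 0<d i (ℕ.m≤n⇒m≤1+n (≡.subst (i ℕ.<_) (Fin.toℕ-inject₁ m) i<m))))
        (≤.≤-respˡ-≈ (next-firstCol m) M≤0))

    consecutive-descends : PositiveThenZero d →
      ConsecutiveRowMinorsNonNegative M → ConsecutiveRowMinorsNonNegative N
    consecutive-descends d-sign M-nonneg ℕ.zero b r s r≡ s-mono = 0≤1
    consecutive-descends d-sign M-nonneg (suc k) b r s r≡ s-mono with d-sign b
    -- With vanishing weights, the minor of `N` is the minor of `M` with all row and column indices
    -- raised by one.
    ... | inj₂ d≈0 = ≤-respʳ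
      (det-cong (λ i j → trans (next (r i) (suc (s j))) (trans (+-congˡ
        (trans (*-congʳ (d≈0 (toℕ (r i)) (≡.subst (b ℕ.≤_) (≡.sym (r≡ i)) (ℕ.m≤m+n b (toℕ i))))) (zeroˡ _)))
        (+-identityʳ _))))
      (M-nonneg (suc k) (suc b) (suc ∘ r) (suc ∘ s) (λ i → ≡.cong suc (r≡ i))
        (λ i j i<j → s≤s (s-mono i j i<j)))
    -- The minor of `N` is bordered by row b and column 0 of `M`. As row i of `N` sits in row i + 1
    -- of `M`, the enlarged block of rows starts at b and is again consecutive.
    ... | inj₁ 0<d = *-cancelˡ-nonneg
      (firstCol-pos (inject₁ (r zero)) (λ m m<b → 0<d m (≡.subst (m ℕ.<_) r₀≡b m<b)))
      (≤-respʳ minor≈ (M-nonneg (suc (suc k)) b r⁺ s⁺ r⁺≡ (lift-mono s-mono)))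
      where
      r⁺ s⁺ : Fin (suc (suc k)) → Fin (suc n)
      r⁺ zero = inject₁ (r zero)
      r⁺ (suc i) = suc (r i)
      s⁺ = Fin.lift 1 s
      r₀≡b : toℕ (r⁺ zero) ≡ b
      r₀≡b = ≡.trans (Fin.toℕ-inject₁ (r zero)) (≡.trans (r≡ zero) (ℕ.+-identityʳ b))
      r⁺≡ : ∀ i → toℕ (r⁺ i) ≡ b ℕ.+ toℕ i
      r⁺≡ zero = ≡.trans r₀≡b (≡.sym (ℕ.+-identityʳ b))
      r⁺≡ (suc i) = ≡.trans (≡.cong suc (r≡ i)) (≡.sym (ℕ.+-suc b (toℕ i)))
      below : ∀ i j → hybrid b (suc (r i)) j ≡ (1⊕ N) (suc (r i)) j
      below i j = hybrid-> {b} {suc (r i)} j (λ ri<b → ℕ.<⇒≱ ri<b (≡.subst (b ℕ.≤_) (≡.sym (r≡ i)) (ℕ.m≤m+n b (toℕ i))))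
      minor≈ : det F (λ i j → M (r⁺ i) (s⁺ j)) ≈ M (inject₁ (r zero)) zero * det F (λ i j → N (r i) (s j))
      minor≈ = begin
        det F (λ i j → M (r⁺ i) (s⁺ j))
          ≈⟨ M-minor-consecutive b r⁺ s⁺ r⁺≡ ⟩
        det F (λ i j → hybrid b (r⁺ i) (s⁺ j))
          ≈⟨ det-firstCol (λ i j → hybrid b (r⁺ i) (s⁺ j)) (λ i → reflexive (below i zero)) ⟩
        hybrid b (inject₁ (r zero)) zero * det F (λ i j → hybrid b (suc (r i)) (suc (s j)))
          ≈⟨ *-cong (reflexive (hybrid-≤ {b} {inject₁ (r zero)} zero (ℕ.≤-reflexive r₀≡b)))
               (det-cong (λ i j → reflexive (below i (suc (s j))))) ⟩
        M (inject₁ (r zero)) zero * det F (λ i j → N (r i) (s j)) ∎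

    totallyNonNegative-ascends : (∀ m → 0# ≤ d m) → TotallyNonNegative F N → TotallyNonNegative F M
    totallyNonNegative-ascends 0≤d N-tnn = M-TotallyNonNegative 0≤d (1⊕-TotallyNonNegative N N-tnn)

  -- Polynomials

  infix 4 _≋_

  _≋_ : Poly F → Poly F → Set ℓ₁
  _≋_ = _≈ₚ_ F

  infixl 6 _⊞_

  _⊞_ : Poly F → Poly F → Poly F
  _⊞_ = _+ₚ_ F

  mulLin-cong : ∀ {u v p q} → u ≈ v → p ≋ q → mulLin F u p ≋ mulLin F v q
  mulLin-cong u≈v p≋q zero    = -‿cong (*-cong u≈v (p≋q zero))
  mulLin-cong u≈v p≋q (suc j) = +-cong (p≋q j) (-‿cong (*-cong u≈v (p≋q (suc j))))

  mulLin-linear : ∀ u v p q → mulLin F u (p ⊞ scaleP F v q) ≋ mulLin F u p ⊞ scaleP F v (mulLin F u q)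
  mulLin-linear u v p q zero = eq u v (p zero) (q zero)
    where
    eq : ∀ u v p q → - (u * (p + v * q)) ≈ - (u * p) + v * - (u * q)
    eq = solve 4 (λ u v p q → :- (u :* (p :+ v :* q)) := :- (u :* p) :+ v :* (:- (u :* q))) refl
  mulLin-linear u v p q (suc j) = eq u v (p j) (q j) (p (suc j)) (q (suc j))
    where
    eq : ∀ u v p q p′ q′ → (p + v * q) - u * (p′ + v * q′) ≈ (p - u * p′) + v * (q - u * q′)
    eq = solve 6 (λ u v p q p′ q′ →
      (p :+ v :* q) :- u :* (p′ :+ v :* q′) := (p :- u :* p′) :+ v :* (q :- u :* q′)) refl

  mulLin-comm : ∀ u v p → mulLin F u (mulLin F v p) ≋ mulLin F v (mulLin F u p)
  mulLin-comm u v p zero = eq u v (p zero)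
    where
    eq : ∀ u v p → - (u * - (v * p)) ≈ - (v * - (u * p))
    eq = solve 3 (λ u v p → :- (u :* (:- (v :* p))) := :- (v :* (:- (u :* p)))) refl
  mulLin-comm u v p (suc ℕ.zero) = eq u v (p 0) (p 1)
    where
    eq : ∀ u v p q → - (v * p) - u * (p - v * q) ≈ - (u * p) - v * (p - u * q)
    eq = solve 4 (λ u v p q → :- (v :* p) :- u :* (p :- v :* q) := :- (u :* p) :- v :* (p :- u :* q)) refl
  mulLin-comm u v p (suc (suc j)) = eq u v (p j) (p (suc j)) (p (suc (suc j)))
    where
    eq : ∀ u v p q r → (p - v * q) - u * (q - v * r) ≈ (p - u * q) - v * (q - u * r)
    eq = solve 5 (λ u v p q r →
      (p :- v :* q) :- u :* (q :- v :* r) := (p :- u :* q) :- v :* (q :- u :* r)) refl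

  -- From x - u = (x - a) + (a - u); the weights a - e of the recurrence come from here.
  mulLin-shift : ∀ a u p → mulLin F u p ≋ mulLin F a p ⊞ scaleP F (a - u) p
  mulLin-shift a u p zero = eq a u (p zero)
    where
    eq : ∀ a u p → - (u * p) ≈ - (a * p) + (a - u) * p
    eq = solve 3 (λ a u p → :- (u :* p) := :- (a :* p) :+ (a :- u) :* p) refl
  mulLin-shift a u p (suc j) = eq a u (p j) (p (suc j))
    where
    eq : ∀ a u q p → q - u * p ≈ (q - a * p) + (a - u) * p
    eq = solve 4 (λ a u q p → q :- u :* p := (q :- a :* p) :+ (a :- u) :* p) refl

  -- A `Poly` may have infinitely many nonzero coefficients, and as a power series x - a can be
  -- invertible. The bound rules this out and gives `mulLin-cancel` a place to start.
  DegreeBelow : ℕ → Poly F → Set ℓ₁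
  DegreeBelow D p = ∀ j → D ℕ.≤ j → p j ≈ 0#

  DegreeBelow-mulLin : ∀ {D p} u → DegreeBelow D p → DegreeBelow (suc D) (mulLin F u p)
  DegreeBelow-mulLin u p≈0 (suc j) (s≤s D≤j) = trans
    (+-cong (p≈0 j D≤j) (-‿cong (trans (*-congˡ (p≈0 (suc j) (ℕ.m≤n⇒m≤1+n D≤j))) (zeroʳ u)))) (-‿inverseʳ 0#)

  DegreeBelow-mono : ∀ {D D′ p} → D ℕ.≤ D′ → DegreeBelow D p → DegreeBelow D′ p
  DegreeBelow-mono D≤D′ p≈0 j D′≤j = p≈0 j (ℕ.≤-trans D≤D′ D′≤j)

  DegreeBelow-prodLin : ∀ us → DegreeBelow (suc (length us)) (prodLin F us)
  DegreeBelow-prodLin [] (suc j) _ = refl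
  DegreeBelow-prodLin (u ∷ us) = DegreeBelow-mulLin u (DegreeBelow-prodLin us)

  DegreeBelow-prodLin-take : ∀ k us → DegreeBelow (suc (length us)) (prodLin F (take k us))
  DegreeBelow-prodLin-take k us = DegreeBelow-mono
    (s≤s (ℕ.≤-trans (ℕ.≤-reflexive (length-take k us)) (ℕ.m⊓n≤n k (length us)))) (DegreeBelow-prodLin (take k us))

  -- The coefficients are compared from the top degree down.
  mulLin-cancel : ∀ D {a u p q} → DegreeBelow D p → DegreeBelow D q →
    constP F u ⊞ mulLin F a p ≋ mulLin F a q → u ≈ 0# × p ≋ q
  mulLin-cancel D {a} {u} {p} {q} deg-p deg-q eq = u≈0 , λ j → descend D j (ℕ.m≤n+m D j)
    where
    down : ∀ j → p (suc j) ≈ q (suc j) → p j ≈ q j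
    down j p′≈q′ = begin
      p j                                              ≈⟨ restore (p j) a (p (suc j)) ⟩
      0# + (p j - a * p (suc j)) + a * p (suc j)       ≈⟨ +-cong (eq (suc j)) (*-congˡ p′≈q′) ⟩
      (q j - a * q (suc j)) + a * q (suc j)            ≈⟨ restore′ (q j) a (q (suc j)) ⟩
      q j                                              ∎
      where
      restore : ∀ x a y → x ≈ 0# + (x - a * y) + a * y
      restore = solve 3 (λ x a y → x := con (+ 0) :+ (x :- a :* y) :+ a :* y) refl
      restore′ : ∀ x a y → (x - a * y) + a * y ≈ x
      restore′ = solve 3 (λ x a y → (x :- a :* y) :+ a :* y := x) refl
    -- `t` bounds the distance from `j` up to `D`; once it is 0, both coefficients vanish.
    descend : ∀ t j → D ℕ.≤ j ℕ.+ t → p j ≈ q j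
    descend ℕ.zero j D≤j = trans (deg-p j D≤j′) (sym (deg-q j D≤j′))
      where D≤j′ = ≡.subst (D ℕ.≤_) (ℕ.+-identityʳ j) D≤j
    descend (suc t) j D≤j = down j (descend t (suc j) (≡.subst (D ℕ.≤_) (ℕ.+-suc j t) D≤j))
    u≈0 : u ≈ 0#
    u≈0 = begin
      u                                ≈⟨ restore u a (p 0) ⟩
      (u + - (a * p 0)) + a * p 0      ≈⟨ +-cong (eq 0) (*-congˡ (descend D 0 ℕ.≤-refl)) ⟩
      - (a * q 0) + a * q 0            ≈⟨ -‿inverseˡ _ ⟩
      0#                               ∎
      where
      restore : ∀ u a y → u ≈ (u + - (a * y)) + a * y
      restore = solve 3 (λ u a y → u := (u :+ :- (a :* y)) :+ a :* y) refl

  -- Expansions in the Newton basis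

  newton : ∀ {n} → List Carrier → (Fin n → Carrier) → Poly F
  newton as x = sumFinP F (λ k → scaleP F (x k) (prodLin F (take (toℕ k) as)))

  newton-linear : ∀ {n} as u (x y : Fin n → Carrier) →
    newton as (λ k → x k - u * y k) ⊞ scaleP F u (newton as y) ≋ newton as x
  newton-linear as u x y = go (λ k → prodLin F (take (toℕ k) as)) x y
    where
    go : ∀ {n} (P : Fin n → Poly F) (x y : Fin n → Carrier) →
      sumFinP F (λ k → scaleP F (x k - u * y k) (P k)) ⊞ scaleP F u (sumFinP F (λ k → scaleP F (y k) (P k)))
        ≋ sumFinP F (λ k → scaleP F (x k) (P k))
    go {ℕ.zero} P x y j = trans (+-identityˡ _) (zeroʳ u)
    go {suc n} P x y j = trans (split (x zero) u (y zero) (P zero j) _ _) (+-congˡ (go (P ∘ suc) (x ∘ suc) (y ∘ suc) j))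
      where
      split : ∀ x u y p s t → (x - u * y) * p + s + u * (y * p + t) ≈ x * p + (s + u * t)
      split = solve 6 (λ x u y p s t → (x :- u :* y) :* p :+ s :+ u :* (y :* p :+ t) := x :* p :+ (s :+ u :* t)) refl

  -- Every basis polynomial except the first contains the factor x - a, which is taken out of the
  -- sum.
  newton-∷ : ∀ {n} a as (x : Fin (suc n) → Carrier) →
    newton (a ∷ as) x ≋ constP F (x zero) ⊞ mulLin F a (newton as (x ∘ suc))
  newton-∷ a as x j = +-cong (constant j) (tail (λ k → prodLin F (take (toℕ k) as)) (x ∘ suc) j)
    where
    constant : scaleP F (x zero) (constP F 1#) ≋ constP F (x zero)
    constant zero    = *-identityʳ _
    constant (suc j) = zeroʳ _
    tail : ∀ {n} (P : Fin n → Poly F) (y : Fin n → Carrier) →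
      sumFinP F (λ k → scaleP F (y k) (mulLin F a (P k))) ≋ mulLin F a (sumFinP F (λ k → scaleP F (y k) (P k)))
    tail {ℕ.zero} P y zero = sym (trans (-‿cong (zeroʳ a)) zero-neg)
      where
      zero-neg : - 0# ≈ 0#
      zero-neg = solve 0 ((:- con (+ 0)) := con (+ 0)) refl
    tail {ℕ.zero} P y (suc j) = sym (trans (+-congˡ (-‿cong (zeroʳ a))) (-‿inverseʳ 0#))
    tail {suc n} P y j = trans (+-congˡ (tail (P ∘ suc) (y ∘ suc) j))
      (trans (+-comm _ _) (trans (sym (mulLin-linear a (y zero) _ (P zero) j))
        (mulLin-cong refl (λ i → +-comm _ _) j)))

  DegreeBelow-newton : ∀ {n} as (x : Fin n → Carrier) → DegreeBelow (suc (length as)) (newton as x)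
  DegreeBelow-newton as x = go (λ k → prodLin F (take (toℕ k) as)) x (λ k → DegreeBelow-prodLin-take (toℕ k) as)
    where
    go : ∀ {n D} (P : Fin n → Poly F) (x : Fin n → Carrier) → (∀ k → DegreeBelow D (P k)) →
      DegreeBelow D (sumFinP F (λ k → scaleP F (x k) (P k)))
    go {ℕ.zero} P x deg j D≤j = refl
    go {suc n} P x deg j D≤j = trans
      (+-cong (trans (*-congˡ (deg zero j D≤j)) (zeroʳ _)) (go (P ∘ suc) (x ∘ suc) (deg ∘ suc) j D≤j)) (+-identityʳ 0#)

  -- Uniqueness of the coordinates of a constant. Subtracting `u` and cancelling x - a determines
  -- the first coordinate and leaves an expansion of 0 in the shorter basis, to which the lemma
  -- applies again.
  newton-constant : ∀ {n} as {u} (x : Fin (suc n) → Carrier) → length as ≡ n → newton as x ≋ constP F u →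
    x zero ≈ u × (∀ k → x (suc k) ≈ 0#)
  newton-constant {ℕ.zero} as {u} x _ eq = trans (sym (trans (+-identityʳ _) (*-identityʳ _))) (eq 0) , λ ()
  newton-constant {suc n} (a ∷ as) {u} x len eq = x₀≈u , λ where
      zero    → proj₁ ih
      (suc k) → proj₂ ih k
    where
    cancelled = mulLin-cancel (suc (suc (length as))) {a} {x zero - u} {newton as (x ∘ suc)} {zeroP F}
      (DegreeBelow-mono (ℕ.n≤1+n _) (DegreeBelow-newton as (x ∘ suc))) (λ _ _ → refl) λ where
        zero → begin
          x zero - u + - (a * newton as (x ∘ suc) 0)   ≈⟨ move (x zero) u _ ⟩
          (x zero + - (a * newton as (x ∘ suc) 0)) - u ≈⟨ +-congʳ (trans (sym (newton-∷ a as x 0)) (eq 0)) ⟩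
          u - u                                        ≈⟨ -‿inverseʳ u ⟩
          0#                                           ≈⟨ 0≈-a0 a ⟩
          - (a * 0#)                                   ∎
        (suc j) → trans (sym (newton-∷ a as x (suc j))) (trans (eq (suc j)) (0≈0-a0 a))
      where
      move : ∀ x u y → x - u + y ≈ (x + y) - u
      move = solve 3 (λ x u y → x :- u :+ y := (x :+ y) :- u) refl
      0≈-a0 : ∀ a → 0# ≈ - (a * 0#)
      0≈-a0 = solve 1 (λ a → con (+ 0) := :- (a :* con (+ 0))) refl
      0≈0-a0 : ∀ a → 0# ≈ 0# - a * 0#
      0≈0-a0 = solve 1 (λ a → con (+ 0) := con (+ 0) :- a :* con (+ 0)) refl
    x₀≈u : x zero ≈ u
    x₀≈u = begin
      x zero            ≈⟨ restore (x zero) u ⟩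
      (x zero - u) + u  ≈⟨ +-congʳ (proj₁ cancelled) ⟩
      0# + u            ≈⟨ +-identityˡ u ⟩
      u                 ∎
      where
      restore : ∀ x u → x ≈ (x - u) + u
      restore = solve 2 (λ x u → x := (x :- u) :+ u) refl
    ih : x (suc zero) ≈ 0# × (∀ k → x (suc (suc k)) ≈ 0#)
    ih = newton-constant as (x ∘ suc) (ℕ.suc-injective len) λ where
      zero    → proj₂ cancelled 0
      (suc j) → proj₂ cancelled (suc j)

  -- Deleting the pivot

  weights : Carrier → (ℕ → Carrier) → ℕ → Carrier
  weights u d zero    = u
  weights u d (suc m) = d m

  -- The deleted element is the last one or equal to a, so that Deletion-prodLin holds; no signs are imposed.
  data Deletion (a : Carrier) : List Carrier → List Carrier → (ℕ → Carrier) → Set (c ⊔ ℓ₁) where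
    last : ∀ {x} → Deletion a (x ∷ []) [] (weights (a - x) (const 0#))
    hit  : ∀ {x xs} → x ≈ a → Deletion a (x ∷ xs) xs (const 0#)
    skip : ∀ {x xs xs′ d} → Deletion a xs xs′ d → Deletion a (x ∷ xs) (x ∷ xs′) (weights (a - x) d)

  Deletion-length : ∀ {a es es′ d} → Deletion a es es′ d → length es ≡ suc (length es′)
  Deletion-length last       = ≡.refl
  Deletion-length (hit _)    = ≡.refl
  Deletion-length (skip del) = ≡.cong suc (Deletion-length del)

  -- A first factor that is kept is split by `mulLin-shift` at m = 0, and for larger m it multiplies
  -- the identity of the tail, commuting with x - a. At a `hit` the deleted factor is x - a itself.
  -- The bound on `m` ensures that `take (suc m)` really adds a factor.
  Deletion-prodLin : ∀ {a es es′ d} → Deletion a es es′ d → ∀ m → m ℕ.< length es →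
    prodLin F (take (suc m) es) ≋ mulLin F a (prodLin F (take m es′)) ⊞ scaleP F (d m) (prodLin F (take m es))
  Deletion-prodLin {a} (last {x}) zero _ = mulLin-shift a x (constP F 1#)
  Deletion-prodLin last (suc m) (s≤s ())
  Deletion-prodLin (hit x≈a) m _ j = trans (mulLin-cong x≈a (λ _ → refl) j)
    (sym (trans (+-congˡ (zeroˡ _)) (+-identityʳ _)))
  Deletion-prodLin {a} (skip {x} del) zero _ = mulLin-shift a x (constP F 1#)
  Deletion-prodLin {a} (skip {x} {xs} {xs′} {d} del) (suc m) (s≤s m<) j = begin
    mulLin F x (prodLin F (take (suc m) xs)) j
      ≈⟨ mulLin-cong refl (Deletion-prodLin del m m<) j ⟩
    mulLin F x (mulLin F a (prodLin F (take m xs′)) ⊞ scaleP F (d m) (prodLin F (take m xs))) j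
      ≈⟨ mulLin-linear x (d m) (mulLin F a (prodLin F (take m xs′))) (prodLin F (take m xs)) j ⟩
    mulLin F x (mulLin F a (prodLin F (take m xs′))) j + d m * mulLin F x (prodLin F (take m xs)) j
      ≈⟨ +-congʳ (mulLin-comm x a (prodLin F (take m xs′)) j) ⟩
    mulLin F a (mulLin F x (prodLin F (take m xs′))) j + d m * mulLin F x (prodLin F (take m xs)) j ∎

  -- The recurrence for the change-of-basis matrix

  IsNewtonExpansion : ∀ {n} → List Carrier → List Carrier → Mat (suc n) → Set ℓ₁
  IsNewtonExpansion es as M = ∀ m → prodLin F (take (toℕ m) es) ≋ newton as (M m)

  firstRow : ∀ {n} as es (M : Mat (suc n)) (N : Mat n) → length as ≡ n → IsNewtonExpansion es as M →
    ∀ j → M zero j ≈ (1⊕ N) zero j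
  firstRow as es M N len expansion with newton-constant as (M zero) len (λ j → sym (expansion zero j))
  ... | M₀₀≈1 , M₀ⱼ≈0 = λ where
    zero    → M₀₀≈1
    (suc j) → M₀ⱼ≈0 j

  -- `N` is read off by solving the recurrence for its rows; it is then shown to be the matrix of
  -- `es′` relative to `as`.
  module Elimination {n : ℕ} {a as es es′ d} (M : Mat (suc (suc n)))
    (as-length : length as ≡ n) (es-length : length es ≡ suc n)
    (expansion : IsNewtonExpansion es (a ∷ as) M) (del : Deletion a es es′ d) where

    es′-length : length es′ ≡ n
    es′-length = ℕ.suc-injective (≡.trans (≡.sym (Deletion-length del)) es-length)

    row : Fin (suc n) → Fin (suc (suc n)) → Carrier
    row m k = M (suc m) k - d (toℕ m) * M (inject₁ m) k

    N : Mat (suc n)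
    N m k = row m (suc k)

    -- The combination of rows expands P_{m+1} - d_m P_m, which is (x - a) P′_m by
    -- `Deletion-prodLin`.
    row-expansion : ∀ m → newton (a ∷ as) (row m) ≋ mulLin F a (prodLin F (take (toℕ m) es′))
    row-expansion m j = begin
      newton (a ∷ as) (row m) j
        ≈⟨ restore (newton (a ∷ as) (row m) j) dP ⟩
      (newton (a ∷ as) (row m) j + dP) - dP
        ≈⟨ +-congʳ (newton-linear (a ∷ as) (d (toℕ m)) (M (suc m)) (M (inject₁ m)) j) ⟩
      newton (a ∷ as) (M (suc m)) j - dP
        ≈⟨ +-congʳ (sym (expansion (suc m) j)) ⟩
      prodLin F (take (suc (toℕ m)) es) j - dP
        ≈⟨ +-congʳ (Deletion-prodLin del (toℕ m) (≡.subst (toℕ m ℕ.<_) (≡.sym es-length) (Fin.toℕ<n m)) j) ⟩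
      (mulLin F a (prodLin F (take (toℕ m) es′)) j + d (toℕ m) * prodLin F (take (toℕ m) es) j) - dP
        ≈⟨ +-congʳ (+-congˡ (*-congˡ (trans
             (reflexive (≡.cong (λ i → prodLin F (take i es) j) (≡.sym (Fin.toℕ-inject₁ m))))
             (expansion (inject₁ m) j)))) ⟩
      (mulLin F a (prodLin F (take (toℕ m) es′)) j + dP) - dP
        ≈⟨ restore (mulLin F a (prodLin F (take (toℕ m) es′)) j) dP ⟨
      mulLin F a (prodLin F (take (toℕ m) es′)) j ∎
      where
      dP = d (toℕ m) * newton (a ∷ as) (M (inject₁ m)) j
      restore : ∀ x y → x ≈ (x + y) - y
      restore = solve 2 (λ x y → x := (x :+ y) :- y) refl

    -- Since (x - a) P′_m is divisible by x - a, its constant coordinate is 0, and cancelling the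
    -- factor turns the other coordinates into those of P′_m.
    cancelled : ∀ m → row m zero ≈ 0# × newton as (N m) ≋ prodLin F (take (toℕ m) es′)
    cancelled m = mulLin-cancel (suc n) {a} {row m zero}
      (≡.subst (λ l → DegreeBelow (suc l) (newton as (N m))) as-length (DegreeBelow-newton as (N m)))
      (≡.subst (λ l → DegreeBelow (suc l) (prodLin F (take (toℕ m) es′))) es′-length
        (DegreeBelow-prodLin-take (toℕ m) es′))
      (λ j → trans (sym (newton-∷ a as (row m) j)) (row-expansion m j))

    N-expansion : IsNewtonExpansion es′ as N
    N-expansion m j = sym (proj₂ (cancelled m) j)

    first : ∀ j → M zero j ≈ (1⊕ N) zero j
    first = firstRow (a ∷ as) es M N (≡.cong suc as-length) expansion

    next : ∀ m j → M (suc m) j ≈ (1⊕ N) (suc m) j + d (toℕ m) * M (inject₁ m) j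
    next m j = trans (restore (M (suc m) j) (d (toℕ m) * M (inject₁ m) j)) (+-congʳ (row≈ j))
      where
      restore : ∀ x y → x ≈ (x - y) + y
      restore = solve 2 (λ x y → x := (x :- y) :+ y) refl
      row≈ : ∀ j → row m j ≈ (1⊕ N) (suc m) j
      row≈ zero    = proj₁ (cancelled m)
      row≈ (suc j) = refl

  -- The procedure

  -- The first condition carries total non-negativity from `N` to `M`; the second carries the
  -- consecutive-row minors from `M` to `N`.
  GoodWeights : (ℕ → Carrier) → Set _
  GoodWeights d = (∀ m → 0# ≤ d m) × PositiveThenZero d

  x<y⇒0<y-x : ∀ {x y} → x < y → 0# < y - x
  x<y⇒0<y-x {x} {y} x<y y-x≤0 = x<y (0≤y-x⇒x≤y (≤-respʳ (eq x y) (x≤0⇒0≤-x y-x≤0)))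
    where
    eq : ∀ x y → - (y - x) ≈ x - y
    eq = solve 2 (λ x y → :- (y :- x) := x :- y) refl

  zero-good : GoodWeights (const 0#)
  zero-good = (λ _ → ≤.refl) , (λ _ → inj₂ (λ _ _ → refl))

  weights-good : ∀ {u d} → 0# < u → GoodWeights d → GoodWeights (weights u d)
  weights-good {u} {d} 0<u (0≤d , d-sign) = nonneg , sign
    where
    nonneg : ∀ m → 0# ≤ weights u d m
    nonneg zero    = <⇒≤ 0<u
    nonneg (suc m) = 0≤d m
    sign : PositiveThenZero (weights u d)
    sign zero = inj₁ (λ _ ())
    sign (suc m) with d-sign m
    ... | inj₁ 0<d = inj₁ λ where
      zero    _         → 0<u
      (suc i) (s≤s i<m) → 0<d i i<m
    ... | inj₂ d≈0 = inj₂ λ where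
      (suc i) (s≤s m≤i) → d≈0 i m≤i

  -- Every element lies below `a`, so the weights a - e are positive through the deleted last
  -- element and 0 afterwards.
  firstGe-nothing : ∀ a x xs → firstGe F a (x ∷ xs) ≡ nothing →
    ∃ λ d → Deletion a (x ∷ xs) (dropLast F (x ∷ xs)) d × GoodWeights d
  firstGe-nothing a x xs found with a ≤? x
  firstGe-nothing a x xs () | yes _
  firstGe-nothing a x [] found | no a≰x = _ , last , weights-good (x<y⇒0<y-x a≰x) zero-good
  firstGe-nothing a x (y ∷ ys) found | no a≰x with firstGe F a (y ∷ ys) in eq
  firstGe-nothing a x (y ∷ ys) () | no a≰x | just _
  ... | nothing with firstGe-nothing a y ys eq
  ...   | d , del , good = _ , skip del , weights-good (x<y⇒0<y-x a≰x) good

  -- The elements before the one found lie below `a` and give positive weights; from the `hit` on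
  -- the weights are 0.
  firstGe-equal : ∀ a es {bs y cs} → firstGe F a es ≡ just (bs , y , cs) → y ≈ a →
    ∃ λ d → Deletion a es (bs ++ cs) d × GoodWeights d
  firstGe-equal a (x ∷ xs) found y≈a with a ≤? x
  firstGe-equal a (x ∷ xs) ≡.refl y≈a | yes _ = _ , hit y≈a , zero-good
  ... | no a≰x with firstGe F a xs in eq
  firstGe-equal a (x ∷ xs) ≡.refl y≈a | no a≰x | just (bs , y , cs) with firstGe-equal a xs eq y≈a
  ...   | d , del , good = _ , skip del , weights-good (x<y⇒0<y-x a≰x) good

  dropLast-Deletion : ∀ a x xs → ∃ λ d → Deletion a (x ∷ xs) (dropLast F (x ∷ xs)) (weights (a - x) d)
  dropLast-Deletion a x [] = _ , last
  dropLast-Deletion a x (y ∷ ys) = _ , skip (proj₂ (dropLast-Deletion a y ys))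

  -- Here the procedure stops without deleting anything. Deleting the last element still yields a
  -- recurrence, whose weight at the position `m` of `y` is a - y < 0, after positive weights only.
  firstGe-greater : ∀ a es {bs y cs} → firstGe F a es ≡ just (bs , y , cs) → ¬ (y ≈ a) →
    ∃ λ d → Deletion a es (dropLast F es) d ×
      ∃ λ m → m ℕ.< length es × (∀ i → i ℕ.< m → 0# < d i) × ¬ (0# ≤ d m)
  firstGe-greater a (x ∷ xs) found y≉a with a ≤? x
  firstGe-greater a (x ∷ xs) ≡.refl x≉a | yes a≤x = _ , proj₂ (dropLast-Deletion a x xs) ,
    0 , s≤s z≤n , (λ _ ()) , λ 0≤a-x → x≉a (≤.antisym (0≤y-x⇒x≤y 0≤a-x) a≤x)
  ... | no a≰x with firstGe F a xs in eq
  firstGe-greater a (x ∷ y ∷ ys) ≡.refl y≉a | no a≰x | just _ with firstGe-greater a (y ∷ ys) eq y≉a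
  ...   | d , del , m , m< , 0<d , d≱0 = _ , skip del , suc m , s≤s m< , 0<d′ , d≱0
    where
    0<d′ : ∀ i → i ℕ.< suc m → 0# < weights (a - x) d i
    0<d′ zero    _         = x<y⇒0<y-x a≰x
    0<d′ (suc i) (s≤s i<m) = 0<d i i<m

  -- Induction along the procedure

  entry-nonneg : ∀ {n} (M : Mat n) → ConsecutiveRowMinorsNonNegative M → ∀ i j → 0# ≤ M i j
  entry-nonneg M M-nonneg i j = ≤-respʳ (eq (M i j)) (M-nonneg 1 (toℕ i) (const i) (const j)
      (λ { zero → ≡.sym (ℕ.+-identityʳ (toℕ i)) }) (λ { zero zero () }))
    where
    eq : ∀ x → x * 1# - 0# ≈ x
    eq = solve 1 (λ x → x :* con (+ 1) :- con (+ 0) := x) refl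

  -- The first implication assumes only minors with consecutive rows, the form in which
  -- non-negativity descends to `N`; the second yields all minors. This asymmetry makes the
  -- induction go through.
  Equivalent : ∀ {n} → List Carrier → List Carrier → Mat (suc n) → Set _
  Equivalent as es M =
    (ConsecutiveRowMinorsNonNegative M → rgRun F as es ≡ true) × (rgRun F as es ≡ true → TotallyNonNegative F M)

  restrictedGrowth : ∀ n as es (M : Mat (suc n)) → length as ≡ n → length es ≡ n →
    IsNewtonExpansion es as M → Equivalent as es M
  restrictedGrowth ℕ.zero [] [] M as-length es-length expansion = (λ _ → ≡.refl) , λ _ →
    -- The 1 × 1 matrix `M` is treated as 1 ⊕ the empty matrix, with all weights 0.
    totallyNonNegative-ascends M (λ ()) (const 0#) (firstRow [] [] M (λ ()) ≡.refl expansion) (λ ())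
      (λ _ → ≤.refl) λ where
        ℕ.zero  _ _ _ _ → 0≤1
        (suc k) r _ _ _ → ⊥-elim (Fin.¬Fin0 (r zero))
  restrictedGrowth (suc n) (a ∷ as) es@(x ∷ xs) M as-length es-length expansion = step
    where
    descend : ∀ es′ → (∃ λ d → Deletion a es es′ d × GoodWeights d) →
      Equivalent as es′ M
    descend es′ (d , del , 0≤d , d-sign) =
      (λ M-nonneg → proj₁ ih (consecutive-descends M N d first next d-sign M-nonneg)) ,
      (λ run → totallyNonNegative-ascends M N d first next 0≤d (proj₂ ih run))
      where
      open Elimination {as = as} M (ℕ.suc-injective as-length) es-length expansion del
      ih = restrictedGrowth n as es′ N (ℕ.suc-injective as-length) es′-length N-expansion

    impossible : (∃ λ d → Deletion a es (dropLast F es) d ×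
        ∃ λ m → m ℕ.< length es × (∀ i → i ℕ.< m → 0# < d i) × ¬ (0# ≤ d m)) →
      ¬ ConsecutiveRowMinorsNonNegative M
    -- In column 0, the entry in row m + 1 is `d m` times the entry in row m. The latter is positive
    -- and the former non-negative, which would force 0 ≤ `d m`.
    impossible (d , del , m , m< , 0<d , d≱0) M-nonneg = d≱0 (≡.subst (λ i → 0# ≤ d i) i≡m
      (*-cancelˡ-nonneg
        (firstCol-pos M N d first next (inject₁ i)
          (λ t t< → 0<d t (≡.subst (t ℕ.<_) (≡.trans (Fin.toℕ-inject₁ i) i≡m) t<)))
        (≤-respʳ (trans (next-firstCol M N d first next i) (*-comm _ _)) (entry-nonneg M M-nonneg (suc i) zero))))
      where
      open Elimination {as = as} M (ℕ.suc-injective as-length) es-length expansion del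
      m<1+n : m ℕ.< suc n
      m<1+n = ≡.subst (m ℕ.<_) es-length m<
      i : Fin (suc n)
      i = Fin.fromℕ< m<1+n
      i≡m : toℕ i ≡ m
      i≡m = Fin.toℕ-fromℕ< m<1+n

    step : Equivalent (a ∷ as) es M
    step with firstGe F a es in eq
    ... | nothing = descend (dropLast F es) (firstGe-nothing a x xs eq)
    ... | just (bs , y , cs) with y ≟ a
    ...   | yes y≈a = descend (bs ++ cs) (firstGe-equal a es eq y≈a)
    ...   | no  y≉a = (λ M-nonneg → contradiction M-nonneg (impossible (firstGe-greater a es eq y≉a))) , λ ()

theorem1p8 : ∀ {c ℓ₁ ℓ₂ : Level} (F : OrderedField c ℓ₁ ℓ₂) (n : ℕ)
    (a e : Vec (OrderedField.Carrier F) n)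
    (M : Fin (suc n) → Fin (suc n) → OrderedField.Carrier F) →
    IsChangeOfBasis F e a M →
    (TotallyNonNegative F M → IsRestrictedGrowth F e a) × (IsRestrictedGrowth F e a → TotallyNonNegative F M)
theorem1p8 F n a e M expansion = proj₁ equivalent ∘ TotallyNonNegative⇒consecutive F M , proj₂ equivalent
  where
  equivalent = restrictedGrowth F n (toList a) (toList e) M (length-toList a) (length-toList e) expansion
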